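{- The sunflower graph $Sf_n$ satisfies $h(Sf_n) = 7$ for $3 \le n \le 4$, $h(Sf_n) = 8$ for $5 \le n \le 6$, and $h(Sf_n) = n+1$ for $n \ge 7$.
   Context: All graphs are finite, simple and undirected. A harmonious coloring of a graph $G$ with $k$ colors is a proper vertex coloring $c : V(G) \to \{1,\dots,k\}$ such that for every two distinct colors $i,j$ there is at most one pair of adjacent vertices colored with $i$ and $j$. The harmonious chromatic number $h(G)$ is the minimum positive integer $k$ for which $G$ has a harmonious coloring with $k$ colors. For $n \ge 3$, the wheel $W_n$ has vertices $v_0, v_1, \dots, v_n$, where $v_1,\dots,v_n$ form a cycle in this cyclic order and $v_0$ is adjacent to all of $v_1,\dots,v_n$. The sunflower graph $Sf_n$ is obtained from $W_n$ by adding $n$ new vertices $u_1,\dots,u_n$, where $u_i$ is joined to $v_i$ and $v_{i+1}$ for $1 \le i \le n-1$, and $u_n$ is joined to $v_n$ and $v_1$. Thus $Sf_n$ has $2n+1$ vertices and $4n$ edges. -}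

module Defs where

open import Data.Fin using (Fin; zero; suc; toℕ)
open import Data.Fin.Properties using (toℕ<n; toℕ-fromℕ<; +↔⊎)
open import Data.Nat using (ℕ; zero; suc; _+_; _≤_; _%_)
open import Data.Nat.DivMod using (_mod_; m%n<n; m<n⇒m%n≡m; n%n≡0)
open import Data.Nat.Properties using (≤-antisym; m≤n⇒m<n∨m≡n; 1+n≢n; <⇒≢; <⇒≤)
open import Data.Product using (_×_; ∃)
open import Data.Sum using (_⊎_; inj₁; inj₂)
open import Data.Sum.Function.Propositional using (_⊎-↔_)
open import Function.Bundles using (_↔_; mk↔ₛ′)
open import Function.Construct.Composition using (_↔-∘_)
open import Function.Construct.Identity using (↔-id)
open import Function.Construct.Symmetry using (↔-sym)
open import Relation.Binary.Construct.Closure.Symmetric using (SymClosure; fwd; bwd)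
  renaming (symmetric to symClosure-sym)
open import Relation.Binary.Definitions using (Symmetric; Irreflexive)
open import Relation.Binary.PropositionalEquality using (_≡_; _≢_; refl; sym; trans; cong)

record Graph : Set₁ where
  field
    Vertex : Set
    order  : ℕ
    finite : Vertex ↔ Fin order
    Adj    : Vertex → Vertex → Set
    adj-sym    : Symmetric Adj
    adj-irrefl : Irreflexive _≡_ Adj

module _ (G : Graph) where
  open Graph G

  -- In `unique` the two edges are oriented so that their first endpoints both
  -- have color i and their second endpoints color j; as i ≢ j, each unordered
  -- pair with colors i and j has exactly one such orientation.
  record IsHarmonious {k : ℕ} (c : Vertex → Fin k) : Set where
    field
      proper : ∀ {u v} → Adj u v → c u ≢ c v
      unique : ∀ {i j} → i ≢ j →
               ∀ {u v x y} →
               Adj u v → c u ≡ i → c v ≡ j →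
               Adj x y → c x ≡ i → c y ≡ j →
               u ≡ x × v ≡ y

  HarmoniouslyColorable : ℕ → Set
  HarmoniouslyColorable k = ∃ λ (c : Vertex → Fin k) → IsHarmonious c

  -- The assertion h(G) = k, as a relation; `h-unique` shows it is functional.
  record HarmoniousChromaticNumber (k : ℕ) : Set where
    field
      positive  : 1 ≤ k
      colorable : HarmoniouslyColorable k
      minimal   : ∀ l → 1 ≤ l → HarmoniouslyColorable l → k ≤ l

  h-unique : ∀ {k l} → HarmoniousChromaticNumber k → HarmoniousChromaticNumber l → k ≡ l
  h-unique {k} {l} p q = ≤-antisym (P.minimal l Q.positive Q.colorable)
                                   (Q.minimal k P.positive P.colorable)
    where module P = HarmoniousChromaticNumber p
          module Q = HarmoniousChromaticNumber q

next : ∀ {n} → Fin n → Fin n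
next {suc n} i = suc (toℕ i) mod suc n

-- Indices run over Fin n, so rim i and outer i are v_{i+1} and u_{i+1} in the
-- numbering v_1, …, v_n and u_1, …, u_n; hub is v_0.
data WheelVertex (n : ℕ) : Set where
  hub : WheelVertex n
  rim : Fin n → WheelVertex n

data WheelEdge {n : ℕ} : WheelVertex n → WheelVertex n → Set where
  spoke : ∀ i → WheelEdge hub (rim i)
  cycle : ∀ i → WheelEdge (rim i) (rim (next i))

data SunflowerVertex (n : ℕ) : Set where
  wheel : WheelVertex n → SunflowerVertex n
  outer : Fin n → SunflowerVertex n

data SunflowerEdge {n : ℕ} : SunflowerVertex n → SunflowerVertex n → Set where
  wheelEdge  : ∀ {a b} → WheelEdge a b → SunflowerEdge (wheel a) (wheel b)
  outer-same : ∀ i → SunflowerEdge (outer i) (wheel (rim i))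
  outer-next : ∀ i → SunflowerEdge (outer i) (wheel (rim (next i)))

wheelVertex↔ : ∀ n → WheelVertex n ↔ Fin (1 + n)
wheelVertex↔ n = mk↔ₛ′ to from to∘from from∘to
  where
  to : WheelVertex n → Fin (1 + n)
  to hub     = zero
  to (rim i) = suc i
  from : Fin (1 + n) → WheelVertex n
  from zero    = hub
  from (suc i) = rim i
  to∘from : ∀ i → to (from i) ≡ i
  to∘from zero    = refl
  to∘from (suc i) = refl
  from∘to : ∀ v → from (to v) ≡ v
  from∘to hub     = refl
  from∘to (rim i) = refl

sunflowerVertex↔⊎ : ∀ n → SunflowerVertex n ↔ (WheelVertex n ⊎ Fin n)
sunflowerVertex↔⊎ n = mk↔ₛ′ to from to∘from from∘to
  where
  to : SunflowerVertex n → WheelVertex n ⊎ Fin n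
  to (wheel a) = inj₁ a
  to (outer i) = inj₂ i
  from : WheelVertex n ⊎ Fin n → SunflowerVertex n
  from (inj₁ a) = wheel a
  from (inj₂ i) = outer i
  to∘from : ∀ x → to (from x) ≡ x
  to∘from (inj₁ a) = refl
  to∘from (inj₂ i) = refl
  from∘to : ∀ v → from (to v) ≡ v
  from∘to (wheel a) = refl
  from∘to (outer i) = refl

sunflowerVertex↔ : ∀ n → SunflowerVertex n ↔ Fin (1 + n + n)
sunflowerVertex↔ n =
  ↔-sym +↔⊎ ↔-∘ ((wheelVertex↔ n ⊎-↔ ↔-id (Fin n)) ↔-∘ sunflowerVertex↔⊎ n)

next≢ : ∀ {n} → 2 ≤ n → (i : Fin n) → i ≢ next i
next≢ {suc n} 2≤n i i≡next with m≤n⇒m<n∨m≡n (toℕ<n i)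
  | trans (cong toℕ i≡next) (toℕ-fromℕ< (m%n<n (suc (toℕ i)) (suc n)))
... | inj₁ 1+i<n | i≡ = 1+n≢n (sym (trans i≡ (m<n⇒m%n≡m 1+i<n)))
... | inj₂ 1+i≡n | i≡ = <⇒≢ 2≤n (trans (sym (cong suc i≡0)) 1+i≡n)
  where
  i≡0 : toℕ i ≡ 0
  i≡0 = trans i≡ (trans (cong (_% suc n) 1+i≡n) (n%n≡0 (suc n)))

rim-injective : ∀ {n} {i j : Fin n} →
                _≡_ {A = SunflowerVertex n} (wheel (rim i)) (wheel (rim j)) → i ≡ j
rim-injective refl = refl

sunflowerEdge⇒≢ : ∀ {n} → 3 ≤ n → {a b : SunflowerVertex n} → SunflowerEdge a b → a ≢ b
sunflowerEdge⇒≢ 3≤n (wheelEdge (spoke i)) ()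
sunflowerEdge⇒≢ 3≤n (wheelEdge (cycle i)) eq = next≢ (<⇒≤ 3≤n) i (rim-injective eq)
sunflowerEdge⇒≢ 3≤n (outer-same i) ()
sunflowerEdge⇒≢ 3≤n (outer-next i) ()

Sunflower : ∀ n → 3 ≤ n → Graph
Sunflower n 3≤n = record
  { Vertex     = SunflowerVertex n
  ; order      = 1 + n + n
  ; finite     = sunflowerVertex↔ n
  ; Adj        = SymClosure SunflowerEdge
  ; adj-sym    = symClosure-sym SunflowerEdge
  ; adj-irrefl = λ where
      eq (fwd e) → sunflowerEdge⇒≢ 3≤n e eq
      eq (bwd e) → sunflowerEdge⇒≢ 3≤n e (sym eq)
  }

{-# OPTIONS --safe #-}

-- Vertices at distance at most 2 receive different colours, so the wheel alone
-- needs n + 1 colours, and an outer vertex can only repeat the colour of a rim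
-- vertex at distance at least 3 from it.  No such rim vertex exists for n ≤ 4,
-- and for n = 5, 6 there are too few pairs of rim colours for enough outer
-- vertices to do this; hence the extra colours.  For n ≥ 7 let u_i repeat the
-- colour of v_{i+3}: the edges outside the hub then join rim colours at cyclic
-- differences ±1, ±2, ±3, which are six distinct residues mod n, so a pair of
-- colours determines its edge.
module Submission where

open import Defs
open import Data.Fin using (Fin; zero; suc; toℕ)
open import Data.Fin.Patterns using (0F; 1F; 2F; 3F; 4F; 5F; 6F; 7F)
open import Data.Fin.Properties
  using (_≟_; all?; any?; toℕ<n; toℕ-fromℕ<; toℕ-injective; suc-injective; injective⇒≤; +↔⊎)
open import Data.Nat using (ℕ; zero; suc; _+_; _∸_; _≤_; _<_; _%_; z≤n; s≤s)
open import Data.Nat.DivMod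
  using (m<n⇒m%n≡m; m≤n⇒[n∸m]%m≡n%m; %-distribˡ-+; m%n%n≡m%n; [m+n]%n≡m%n)
open import Data.Nat.Properties
  using (≤-trans; ≤-antisym; m≤n⇒m<n∨m≡n; <⇒≢; <⇒≤; ≮⇒≥; _<?_; +-comm; +-identityʳ;
         +-cancelʳ-≡; +-mono-<; m∸n+n≡m; m<n+o⇒m∸n<o; m≢1+n+m)
open import Data.Product using (_×_; _,_; ∃; proj₁; proj₂)
open import Data.Sum using (_⊎_; inj₁; inj₂; [_,_]′)
open import Data.Sum.Function.Propositional using (_⊎-↔_)
open import Data.Vec using ([]; _∷_; lookup)
open import Function using (_∘_)
open import Function.Bundles using (mk↣; module Injection)
open import Function.Construct.Composition using (_↔-∘_; _↣-∘_)
open import Function.Construct.Identity using (↔-id)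
open import Function.Construct.Symmetry using (↔-sym)
open import Function.Properties.Inverse using (↔⇒↣)
open import Relation.Binary.Construct.Closure.Symmetric using (SymClosure; fwd; bwd)
open import Relation.Binary.PropositionalEquality
  using (_≡_; _≢_; refl; sym; trans; cong; subst; ≢-sym; module ≡-Reasoning)
open import Relation.Nullary using (¬_; Dec; yes; no; contradiction)
open import Relation.Nullary.Decidable
  using (¬?; _×-dec_; _⊎-dec_; _→-dec_; decidable-stable; from-yes)

-- Lower bounds

module _ {G : Graph} {k : ℕ} {c : Graph.Vertex G → Fin k} (h : IsHarmonious G c) where
  open Graph G
  open IsHarmonious h

  -- Equal colours on `u` and `v` would give the edges `u w` and `v w` the same pair of colours, so
  -- `unique` would identify them.
  common-neighbour⇒colours≢ : ∀ {u v w} → Adj u w → Adj v w → u ≢ v → c u ≢ c v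
  common-neighbour⇒colours≢ uw vw u≢v cu≡cv =
    u≢v (proj₁ (unique (proper uw) uw refl refl vw (sym cu≡cv) refl))

module _ {n : ℕ} where

  -- These are the rim vertices at distance at most 2 from u_i: its neighbours v_i and v_{i+1}, then
  -- v_{i+2} and v_{i-1}. Writing the last as `i ≡ next j` avoids a predecessor function.
  NearRim : Fin n → Fin n → Set
  NearRim i j = i ≡ j ⊎ next i ≡ j ⊎ next (next i) ≡ j ⊎ i ≡ next j

  nearRim? : ∀ i j → Dec (NearRim i j)
  nearRim? i j = i ≟ j ⊎-dec next i ≟ j ⊎-dec next (next i) ≟ j ⊎-dec i ≟ next j

-- Constraints on an arbitrary harmonious colouring

module ColouredSunflower {n : ℕ} (3≤n : 3 ≤ n) {l : ℕ} {c : SunflowerVertex n → Fin l}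
                         (h : IsHarmonious (Sunflower n 3≤n) c) where
  open IsHarmonious h

  hubColour : Fin l
  hubColour = c (wheel hub)

  rimColour outerColour : Fin n → Fin l
  rimColour   i = c (wheel (rim i))
  outerColour i = c (outer i)

  wheel-injective : ∀ a b → c (wheel a) ≡ c (wheel b) → a ≡ b
  wheel-injective hub     hub     eq = refl
  wheel-injective hub     (rim j) eq = contradiction eq (proper (fwd (wheelEdge (spoke j))))
  wheel-injective (rim i) hub     eq = contradiction eq (proper (bwd (wheelEdge (spoke i))))
  wheel-injective (rim i) (rim j) eq with i ≟ j
  ... | yes i≡j = cong rim i≡j
  ... | no  i≢j = contradiction eq
    (common-neighbour⇒colours≢ h (bwd (wheelEdge (spoke i))) (bwd (wheelEdge (spoke j)))
      (i≢j ∘ rim-injective))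

  outer≢hub : ∀ i → outerColour i ≢ hubColour
  outer≢hub i =
    common-neighbour⇒colours≢ h (fwd (outer-same i)) (fwd (wheelEdge (spoke i))) λ ()

  outer≢near : ∀ {i j} → NearRim i j → outerColour i ≢ rimColour j
  outer≢near {i} (inj₁ refl) = proper (fwd (outer-same i))
  outer≢near {i} (inj₂ (inj₁ refl)) = proper (fwd (outer-next i))
  outer≢near {i} (inj₂ (inj₂ (inj₁ refl))) =
    common-neighbour⇒colours≢ h (fwd (outer-next i)) (bwd (wheelEdge (cycle (next i)))) λ ()
  outer≢near {j = j} (inj₂ (inj₂ (inj₂ refl))) =
    common-neighbour⇒colours≢ h (fwd (outer-same (next j))) (fwd (wheelEdge (cycle j))) λ ()

  outer≢outer-next : ∀ i → outerColour i ≢ outerColour (next i)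
  outer≢outer-next i =
    common-neighbour⇒colours≢ h (fwd (outer-next i)) (fwd (outer-same (next i)))
      (next≢ (<⇒≤ 3≤n) i ∘ outer-injective)
    where
    outer-injective : ∀ {i j : Fin n} → outer i ≡ outer j → i ≡ j
    outer-injective refl = refl

  -- Otherwise the edges u_i v_a and u_j v_b would carry the same two colours in opposite order, and
  -- `unique` would identify an outer vertex with a rim vertex.
  outers-cross : ∀ {i j a b} → SunflowerEdge (outer i) (wheel (rim a)) →
                 SunflowerEdge (outer j) (wheel (rim b)) →
                 outerColour i ≡ rimColour b → outerColour j ≢ rimColour a
  outers-cross ia jb i≡b j≡a
    with () ← proj₁ (unique (proper (fwd ia)) (fwd ia) refl refl (bwd jb) (sym i≡b) j≡a)

  -- Since `outer≢hub` excludes the hub, such a colour is absent from the whole wheel.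
  New : Fin n → Set
  New i = ∀ j → outerColour i ≢ rimColour j

  new⊎far : ∀ i → New i ⊎ ∃ λ j → ¬ NearRim i j × outerColour i ≡ rimColour j
  new⊎far i with any? (λ j → outerColour i ≟ rimColour j)
  ... | yes (j , eq) = inj₂ (j , (λ near → outer≢near near eq) , eq)
  ... | no  ¬∃       = inj₁ λ j eq → ¬∃ (j , eq)

  -- The wheel already uses `1 + n` distinct colours, so adjoining `k` distinct new ones injects
  -- `1 + n + k` elements into `Fin l`.
  new-colours : ∀ k (x : Fin k → Fin n) → (∀ p → New (x p)) →
                (∀ p q → p ≢ q → outerColour (x p) ≢ outerColour (x q)) → 1 + n + k ≤ l
  new-colours k x new distinct = injective⇒≤ (Injection.injective
    (mk↣ (λ {s} {t} → colour-injective s t) ↣-∘ ↔⇒↣ (vertices ↔-∘ +↔⊎)))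
    where
    vertices = ↔-sym (wheelVertex↔ n) ⊎-↔ ↔-id (Fin k)

    colour : WheelVertex n ⊎ Fin k → Fin l
    colour = [ c ∘ wheel , outerColour ∘ x ]′

    new≢wheel : ∀ p a → outerColour (x p) ≢ c (wheel a)
    new≢wheel p hub     = outer≢hub (x p)
    new≢wheel p (rim j) = new p j

    colour-injective : ∀ s t → colour s ≡ colour t → s ≡ t
    colour-injective (inj₁ a) (inj₁ b) eq = cong inj₁ (wheel-injective a b eq)
    colour-injective (inj₁ a) (inj₂ q) eq = contradiction (sym eq) (new≢wheel q a)
    colour-injective (inj₂ p) (inj₁ b) eq = contradiction eq (new≢wheel p b)
    colour-injective (inj₂ p) (inj₂ q) eq =
      cong inj₂ (decidable-stable (p ≟ q) λ p≢q → distinct p q p≢q eq)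

  1+n≤l : 1 + n ≤ l
  1+n≤l = subst (_≤ l) (+-identityʳ (1 + n)) (new-colours 0 (λ ()) (λ ()) (λ ()))

  new⇒2+n≤l : ∀ {i} → New i → 1 + n + 1 ≤ l
  new⇒2+n≤l {i} new = new-colours 1 (λ _ → i) (λ _ → new)
    λ { 0F 0F 0≢0 → contradiction refl 0≢0 }

  consecutive-new⇒3+n≤l : ∀ {i} → New i → New (next i) → 1 + n + 2 ≤ l
  consecutive-new⇒3+n≤l {i} new new′ = new-colours 2 (lookup (i ∷ next i ∷ []))
    (λ { 0F → new ; 1F → new′ })
    λ { 0F 0F p≢q → contradiction refl p≢q
      ; 0F 1F _   → outer≢outer-next i
      ; 1F 0F _   → ≢-sym (outer≢outer-next i)
      ; 1F 1F p≢q → contradiction refl p≢q }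

-- Lower bounds for n = 3, 4, 5, 6

module _ {l : ℕ} (3≤n : 3 ≤ 3) {c : SunflowerVertex 3 → Fin l}
         (h : IsHarmonious (Sunflower 3 3≤n) c) where
  open ColouredSunflower 3≤n h

  lower₃ : 7 ≤ l
  -- Any two of the three outer vertices are consecutive, so all three new colours differ.
  lower₃ = new-colours 3 (λ i → i) (λ i j → outer≢near (all-near i j)) distinct
    where
    all-near : ∀ i j → NearRim {3} i j
    all-near = from-yes (all? λ (i : Fin 3) → all? λ j → nearRim? i j)

    consecutive : ∀ (i j : Fin 3) → i ≢ j → next i ≡ j ⊎ next j ≡ i
    consecutive = from-yes (all? λ (i : Fin 3) → all? λ j →
      ¬? (i ≟ j) →-dec (next i ≟ j ⊎-dec next j ≟ i))

    distinct : ∀ i j → i ≢ j → outerColour i ≢ outerColour j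
    distinct i j i≢j with consecutive i j i≢j
    ... | inj₁ refl = outer≢outer-next i
    ... | inj₂ refl = ≢-sym (outer≢outer-next j)

module _ {l : ℕ} (3≤n : 3 ≤ 4) {c : SunflowerVertex 4 → Fin l}
         (h : IsHarmonious (Sunflower 4 3≤n) c) where
  open ColouredSunflower 3≤n h

  lower₄ : 7 ≤ l
  lower₄ = consecutive-new⇒3+n≤l (new 0F) (new 1F)
    where
    all-near : ∀ i j → NearRim {4} i j
    all-near = from-yes (all? λ (i : Fin 4) → all? λ j → nearRim? i j)

    new : ∀ i → New i
    new i j = outer≢near (all-near i j)

module _ {l : ℕ} (3≤n : 3 ≤ 5) {c : SunflowerVertex 5 → Fin l}
         (h : IsHarmonious (Sunflower 5 3≤n) c) where
  open ColouredSunflower 3≤n h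

  -- For n = 5, v_{i+3} is the only rim vertex not near u_i, hence the only one whose colour u_i can
  -- repeat.
  Opposite : Fin 5 → Set
  Opposite i = outerColour i ≡ rimColour (next (next (next i)))

  opposite? : ∀ i → Dec (Opposite i)
  opposite? i = outerColour i ≟ rimColour (next (next (next i)))

  ¬opposite⇒new : ∀ {i} → ¬ Opposite i → New i
  ¬opposite⇒new {i} ¬opp j eq with far i j (λ near → outer≢near near eq)
    where
    far : ∀ (i j : Fin 5) → ¬ NearRim i j → next (next (next i)) ≡ j
    far = from-yes (all? λ (i : Fin 5) → all? λ j →
      ¬? (nearRim? i j) →-dec (next (next (next i)) ≟ j))
  ... | refl = ¬opp eq

  lower₅ : 8 ≤ l
  lower₅ with opposite? 0F | opposite? 1F
  -- If u_0 repeats v_3, its edges to v_0 and v_1 use up the colour pairs of v_0, v_3 and of v_1,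
  -- v_3. Then u_2 cannot repeat v_0 and u_3 cannot repeat v_1, so both are new. The next case is
  -- this one shifted by 1.
  ... | yes opp₀ | _        = consecutive-new⇒3+n≤l {2F}
    (¬opposite⇒new (outers-cross (outer-same 0F) (outer-next 2F) opp₀))
    (¬opposite⇒new (outers-cross (outer-next 0F) (outer-same 3F) opp₀))
  ... | no  _    | yes opp₁ = consecutive-new⇒3+n≤l {3F}
    (¬opposite⇒new (outers-cross (outer-same 1F) (outer-next 3F) opp₁))
    (¬opposite⇒new (outers-cross (outer-next 1F) (outer-same 4F) opp₁))
  ... | no ¬opp₀ | no ¬opp₁ = consecutive-new⇒3+n≤l
    (¬opposite⇒new ¬opp₀) (¬opposite⇒new ¬opp₁)

module _ {l : ℕ} (3≤n : 3 ≤ 6) {c : SunflowerVertex 6 → Fin l}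
         (h : IsHarmonious (Sunflower 6 3≤n) c) where
  open ColouredSunflower 3≤n h

  -- In either case u_i occupies the pair of colours of two antipodal rim
  -- vertices: v_i, v_{i+3} in the first case and v_{i+1}, v_{i+4} in the second.
  Third Fourth : Fin 6 → Set
  Third  i = outerColour i ≡ rimColour (next (next (next i)))
  Fourth i = outerColour i ≡ rimColour (next (next (next (next i))))

  new⊎third⊎fourth : ∀ i → New i ⊎ Third i ⊎ Fourth i
  new⊎third⊎fourth i with new⊎far i
  ... | inj₁ new = inj₁ new
  ... | inj₂ (j , ¬near , eq) with far i j ¬near
    where
    far : ∀ (i j : Fin 6) → ¬ NearRim i j →
          next (next (next i)) ≡ j ⊎ next (next (next (next i))) ≡ j
    far = from-yes (all? λ (i : Fin 6) → all? λ j → ¬? (nearRim? i j) →-dec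
      (next (next (next i)) ≟ j ⊎-dec next (next (next (next i))) ≟ j))
  ...   | inj₁ refl = inj₂ (inj₁ eq)
  ...   | inj₂ refl = inj₂ (inj₂ eq)

  -- Both conditions name the rim vertex v_{i+4}, but u_i and u_{i+1} have a common neighbour and
  -- cannot share its colour.
  fourth⇒¬third-next : ∀ i → Fourth i → ¬ Third (next i)
  fourth⇒¬third-next i fourth third = outer≢outer-next i (trans fourth (sym third))

  fourth-next : ∀ i → Fourth i → New (next i) ⊎ Fourth (next i)
  fourth-next i fourth with new⊎third⊎fourth (next i)
  ... | inj₁ new            = inj₁ new
  ... | inj₂ (inj₁ third)   = contradiction third (fourth⇒¬third-next i fourth)
  ... | inj₂ (inj₂ fourth′) = inj₂ fourth′

  fourth-next³ : ∀ i → Fourth i → ∃ New ⊎ Fourth (next (next (next i)))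
  fourth-next³ i p with fourth-next i p
  ... | inj₁ new = inj₁ (_ , new)
  ... | inj₂ q with fourth-next (next i) q
  ...   | inj₁ new = inj₁ (_ , new)
  ...   | inj₂ r with fourth-next (next (next i)) r
  ...     | inj₁ new = inj₁ (_ , new)
  ...     | inj₂ s   = inj₂ s

  -- Without a new colour, `Fourth` spreads from each outer vertex to the next. If it holds at 0 it
  -- reaches 3, and u_0, u_3 both occupy the pair v_1, v_4. If `Third` holds at 0, it fails at 3
  -- because of the pair v_0, v_3; so `Fourth` holds at 3, spreads to 5, and contradicts `Third` at
  -- 0.
  ∃new : ∃ New
  ∃new with new⊎third⊎fourth 0F
  ... | inj₁ new = _ , new
  ... | inj₂ (inj₂ fourth₀) with fourth-next³ 0F fourth₀
  ...   | inj₁ new     = new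
  ...   | inj₂ fourth₃ =
    contradiction fourth₃ (outers-cross (outer-next 0F) (outer-next 3F) fourth₀)
  ∃new | inj₂ (inj₁ third₀) with new⊎third⊎fourth 3F
  ... | inj₁ new = _ , new
  ... | inj₂ (inj₁ third₃) =
    contradiction third₃ (outers-cross (outer-same 0F) (outer-same 3F) third₀)
  ... | inj₂ (inj₂ fourth₃) with fourth-next 3F fourth₃
  ...   | inj₁ new = _ , new
  ...   | inj₂ fourth₄ with fourth-next 4F fourth₄
  ...     | inj₁ new     = _ , new
  ...     | inj₂ fourth₅ = contradiction third₀ (fourth⇒¬third-next 5F fourth₅)

  lower₆ : 8 ≤ l
  lower₆ = new⇒2+n≤l (proj₂ ∃new)

-- Harmonious colourings

module _ {n : ℕ} where

  -- Indexing the 4n edges by kind and position, each with one fixed orientation, makes statements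
  -- about all edges decidable by enumeration.
  source target : Fin 4 → Fin n → SunflowerVertex n
  source 0F i = wheel hub
  source 1F i = wheel (rim i)
  source 2F i = outer i
  source 3F i = outer i
  target 0F i = wheel (rim i)
  target 1F i = wheel (rim (next i))
  target 2F i = wheel (rim i)
  target 3F i = wheel (rim (next i))

  data EdgeView : SunflowerVertex n → SunflowerVertex n → Set where
    edge : ∀ k i → EdgeView (source k i) (target k i)

  edgeView : ∀ {a b} → SunflowerEdge a b → EdgeView a b
  edgeView (wheelEdge (spoke i)) = edge 0F i
  edgeView (wheelEdge (cycle i)) = edge 1F i
  edgeView (outer-same i)        = edge 2F i
  edgeView (outer-next i)        = edge 3F i

  module _ {l : ℕ} (c : SunflowerVertex n → Fin l) where

    Parallel Crossing : Fin 4 → Fin n → Fin 4 → Fin n → Set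
    Parallel k i m j = c (source k i) ≡ c (source m j) × c (target k i) ≡ c (target m j)
    Crossing k i m j = c (source k i) ≡ c (target m j) × c (target k i) ≡ c (source m j)

    -- Two oriented edges can share a colour pair in the same order or in reverse. Comparing an edge
    -- with itself in `crossing` yields properness.
    record EdgesDistinguished : Set where
      field
        parallel : ∀ k i m j → Parallel k i m j → k ≡ m × i ≡ j
        crossing : ∀ k i m j → ¬ Crossing k i m j

    parallel? : Dec (∀ k i m j → Parallel k i m j → k ≡ m × i ≡ j)
    parallel? = all? λ k → all? λ i → all? λ m → all? λ j →
      (c (source k i) ≟ c (source m j) ×-dec c (target k i) ≟ c (target m j))
        →-dec (k ≟ m ×-dec i ≟ j)

    crossing? : Dec (∀ k i m j → ¬ Crossing k i m j)
    crossing? = all? λ k → all? λ i → all? λ m → all? λ j →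
      ¬? (c (source k i) ≟ c (target m j) ×-dec c (target k i) ≟ c (source m j))

module _ {n : ℕ} (3≤n : 3 ≤ n) {l : ℕ} {c : SunflowerVertex n → Fin l}
         (d : EdgesDistinguished c) where
  open EdgesDistinguished d

  edge-proper : ∀ {a b} → SunflowerEdge a b → c a ≢ c b
  edge-proper e eq with edgeView e
  ... | edge k i = crossing k i k i (eq , sym eq)

  edge-parallel : ∀ {a b x y} → SunflowerEdge a b → SunflowerEdge x y →
                  c a ≡ c x → c b ≡ c y → a ≡ x × b ≡ y
  edge-parallel e e′ p q with edgeView e | edgeView e′
  ... | edge k i | edge m j with parallel k i m j (p , q)
  ...   | refl , refl = refl , refl

  edge-crossing : ∀ {a b x y} → SunflowerEdge a b → SunflowerEdge x y →
                  c a ≡ c y → c b ≢ c x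
  edge-crossing e e′ p q with edgeView e | edgeView e′
  ... | edge k i | edge m j = crossing k i m j (p , q)

  distinguished⇒harmonious : IsHarmonious (Sunflower n 3≤n) c
  distinguished⇒harmonious = record { proper = proper ; unique = λ _ → unique }
    where
    proper : ∀ {u v} → SymClosure SunflowerEdge u v → c u ≢ c v
    proper (fwd e) = edge-proper e
    proper (bwd e) = ≢-sym (edge-proper e)

    unique : ∀ {i j u v x y} →
             SymClosure SunflowerEdge u v → c u ≡ i → c v ≡ j →
             SymClosure SunflowerEdge x y → c x ≡ i → c y ≡ j → u ≡ x × v ≡ y
    unique (fwd e) refl refl (fwd e′) p q = edge-parallel e e′ (sym p) (sym q)
    unique (fwd e) refl refl (bwd e′) p q = contradiction (sym q) (edge-crossing e e′ (sym p))
    unique (bwd e) refl refl (fwd e′) p q = contradiction (sym p) (edge-crossing e e′ (sym q))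
    unique (bwd e) refl refl (bwd e′) p q with edge-parallel e e′ (sym q) (sym p)
    ... | refl , refl = refl , refl

-- Explicit colourings for n = 3, 4, 5, 6

colouring : ∀ {n l} → Fin l → (Fin n → Fin l) → (Fin n → Fin l) → SunflowerVertex n → Fin l
colouring a r o (wheel hub)     = a
colouring a r o (wheel (rim i)) = r i
colouring a r o (outer i)       = o i

colouring₃ : SunflowerVertex 3 → Fin 7
colouring₃ = colouring 0F (lookup (1F ∷ 2F ∷ 3F ∷ [])) (lookup (4F ∷ 5F ∷ 6F ∷ []))

colouring₄ : SunflowerVertex 4 → Fin 7
colouring₄ = colouring 0F (lookup (1F ∷ 2F ∷ 3F ∷ 4F ∷ [])) (lookup (5F ∷ 6F ∷ 5F ∷ 6F ∷ []))

-- Two new colours cannot alternate around an odd cycle, so the last outer vertex repeats its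
-- opposite rim vertex.
colouring₅ : SunflowerVertex 5 → Fin 8
colouring₅ = colouring 0F (lookup (1F ∷ 2F ∷ 3F ∷ 4F ∷ 5F ∷ []))
                          (lookup (6F ∷ 7F ∷ 6F ∷ 7F ∷ 3F ∷ []))

-- Every second outer vertex takes the new colour; the other three repeat v_{i+3}, each using a
-- different antipodal pair.
colouring₆ : SunflowerVertex 6 → Fin 8
colouring₆ = colouring 0F (lookup (1F ∷ 2F ∷ 3F ∷ 4F ∷ 5F ∷ 6F ∷ []))
                          (lookup (7F ∷ 5F ∷ 7F ∷ 1F ∷ 7F ∷ 3F ∷ []))

distinguished₃ : EdgesDistinguished colouring₃
distinguished₃ = record
  { parallel = from-yes (parallel? colouring₃) ; crossing = from-yes (crossing? colouring₃) }

distinguished₄ : EdgesDistinguished colouring₄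
distinguished₄ = record
  { parallel = from-yes (parallel? colouring₄) ; crossing = from-yes (crossing? colouring₄) }

distinguished₅ : EdgesDistinguished colouring₅
distinguished₅ = record
  { parallel = from-yes (parallel? colouring₅) ; crossing = from-yes (crossing? colouring₅) }

distinguished₆ : EdgesDistinguished colouring₆
distinguished₆ = record
  { parallel = from-yes (parallel? colouring₆) ; crossing = from-yes (crossing? colouring₆) }

-- Rotations of the rim

advance : ∀ {n} → ℕ → Fin n → Fin n
advance zero    i = i
advance (suc d) i = next (advance d i)

advance-next : ∀ {n} d (i : Fin n) → advance d (next i) ≡ next (advance d i)
advance-next zero    i = refl
advance-next (suc d) i = cong next (advance-next d i)

toℕ-advance : ∀ {n} d (i : Fin (suc n)) → toℕ (advance d i) ≡ (d + toℕ i) % suc n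
toℕ-advance {n} zero    i = sym (m<n⇒m%n≡m (toℕ<n i))
toℕ-advance {n} (suc d) i = begin
  toℕ (next (advance d i))           ≡⟨ toℕ-fromℕ< _ ⟩
  suc (toℕ (advance d i)) % suc n    ≡⟨ cong (λ t → suc t % suc n) (toℕ-advance d i) ⟩
  suc ((d + toℕ i) % suc n) % suc n  ≡⟨ suc-% (d + toℕ i) ⟩
  suc (d + toℕ i) % suc n            ∎
  where
  open ≡-Reasoning
  suc-% : ∀ t → suc (t % suc n) % suc n ≡ suc t % suc n
  suc-% t = begin
    suc (t % suc n) % suc n                  ≡⟨ %-distribˡ-+ 1 (t % suc n) (suc n) ⟩
    (1 % suc n + t % suc n % suc n) % suc n  ≡⟨ cong (λ r → (1 % suc n + r) % suc n)
                                                     (m%n%n≡m%n t (suc n)) ⟩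
    (1 % suc n + t % suc n) % suc n          ≡⟨ %-distribˡ-+ 1 t (suc n) ⟨
    suc t % suc n                            ∎

advance-n : ∀ {n} (i : Fin n) → advance n i ≡ i
advance-n {suc n} i = toℕ-injective (begin
  toℕ (advance (suc n) i)  ≡⟨ toℕ-advance (suc n) i ⟩
  (suc n + toℕ i) % suc n  ≡⟨ cong (_% suc n) (+-comm (suc n) (toℕ i)) ⟩
  (toℕ i + suc n) % suc n  ≡⟨ [m+n]%n≡m%n (toℕ i) (suc n) ⟩
  toℕ i % suc n            ≡⟨ m<n⇒m%n≡m (toℕ<n i) ⟩
  toℕ i                    ∎)
  where open ≡-Reasoning

-- A full turn is the identity, so all but one of its steps undo `next`.
next-injective : ∀ {n} {i j : Fin n} → next i ≡ next j → i ≡ j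
next-injective {suc n} {i} {j} eq = begin
  i                   ≡⟨ advance-n i ⟨
  next (advance n i)  ≡⟨ advance-next n i ⟨
  advance n (next i)  ≡⟨ cong (advance n) eq ⟩
  advance n (next j)  ≡⟨ advance-next n j ⟩
  next (advance n j)  ≡⟨ advance-n j ⟩
  j                   ∎
  where open ≡-Reasoning

-- Without wrapping the shifted index is strictly larger than `i`. With wrapping exactly one full
-- turn is subtracted, so a fixed point would make the shift a full turn.
advance≢ : ∀ {n} d → suc d < n → (i : Fin n) → i ≢ advance (suc d) i
advance≢ {suc n} d d<n i eq with suc d + toℕ i <? suc n
  | trans (cong toℕ eq) (toℕ-advance (suc d) i)
... | yes d+i<n | i≡ = m≢1+n+m (toℕ i) (trans i≡ (m<n⇒m%n≡m d+i<n))
... | no  d+i≮n | i≡ = <⇒≢ d<n (sym (+-cancelʳ-≡ (toℕ i) (suc n) (suc d) (begin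
  suc n + toℕ i                            ≡⟨ +-comm (suc n) (toℕ i) ⟩
  toℕ i + suc n                            ≡⟨ cong (_+ suc n) i≡ ⟩
  (suc d + toℕ i) % suc n + suc n          ≡⟨ cong (_+ suc n) (m≤n⇒[n∸m]%m≡n%m n≤d+i) ⟨
  (suc d + toℕ i ∸ suc n) % suc n + suc n  ≡⟨ cong (_+ suc n) (m<n⇒m%n≡m wrapped<n) ⟩
  suc d + toℕ i ∸ suc n + suc n            ≡⟨ m∸n+n≡m n≤d+i ⟩
  suc d + toℕ i                            ∎)))
  where
  open ≡-Reasoning
  n≤d+i : suc n ≤ suc d + toℕ i
  n≤d+i = ≮⇒≥ d+i≮n
  wrapped<n : suc d + toℕ i ∸ suc n < suc n
  wrapped<n = m<n+o⇒m∸n<o (suc d + toℕ i) (suc n) (+-mono-< d<n (toℕ<n i))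

-- The colouring for n at least 7

rotatedColouring : ∀ n → SunflowerVertex n → Fin (suc n)
rotatedColouring n = colouring zero suc (suc ∘ advance 3)

module _ {n : ℕ} (7≤n : 7 ≤ n) where

  -- The bound 7 enters here: the shifts 1 to 6 are nonzero modulo n. The index `d` stands for the
  -- shift d + 1.
  rotation≢ : ∀ (d : Fin 6) (i : Fin n) → i ≢ advance (suc (toℕ d)) i
  rotation≢ d = advance≢ (toℕ d) (≤-trans (s≤s (toℕ<n d)) 7≤n)

  rotated-distinguished : EdgesDistinguished (rotatedColouring n)
  rotated-distinguished = record { parallel = parallel ; crossing = crossing }
    where
    c = rotatedColouring n

    next³-injective : ∀ {i j : Fin n} → suc (advance 3 i) ≡ suc (advance 3 j) → i ≡ j
    next³-injective = next-injective ∘ next-injective ∘ next-injective ∘ suc-injective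

    -- From source to target the rim colour changes by +1, -3 and -2 for the kinds 1, 2 and 3.
    -- Different kinds differ by 4, 3 or 1, all nonzero modulo n.
    parallel : ∀ k i m j → Parallel c k i m j → k ≡ m × i ≡ j
    parallel 0F i 0F j (_ , refl) = refl , refl
    parallel 0F i 1F j (() , _)
    parallel 0F i 2F j (() , _)
    parallel 0F i 3F j (() , _)
    parallel 1F i 0F j (() , _)
    parallel 2F i 0F j (() , _)
    parallel 3F i 0F j (() , _)
    parallel 1F i 1F j (refl , _) = refl , refl
    parallel 1F i 2F j (refl , q) = contradiction (sym (suc-injective q)) (rotation≢ 3F j)
    parallel 1F i 3F j (refl , q) =
      contradiction (sym (next-injective (suc-injective q))) (rotation≢ 2F j)
    parallel 2F i 1F j (refl , q) = contradiction (suc-injective q) (rotation≢ 3F i)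
    parallel 3F i 1F j (refl , q) =
      contradiction (next-injective (suc-injective q)) (rotation≢ 2F i)
    parallel 2F i 2F j (_ , refl) = refl , refl
    parallel 2F i 3F j (p , refl) = contradiction (sym (next³-injective p)) (rotation≢ 0F j)
    parallel 3F i 2F j (p , refl) = contradiction (next³-injective p) (rotation≢ 0F i)
    parallel 3F i 3F j (_ , q) = refl , next-injective (suc-injective q)

    -- A crossing needs two of the changes +1, -3, -2, possibly equal, to sum to 0 modulo n. The
    -- sums are 2, -2, -1, -6, -5 and -4; the sum -6 calls for the largest shift.
    crossing : ∀ k i m j → ¬ Crossing c k i m j
    crossing 0F i 0F j (() , _)
    crossing 0F i 1F j (() , _)
    crossing 0F i 2F j (() , _)
    crossing 0F i 3F j (() , _)
    crossing 1F i 0F j (_ , ())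
    crossing 2F i 0F j (_ , ())
    crossing 3F i 0F j (_ , ())
    crossing 1F i 1F j (refl , q) = rotation≢ 1F j (sym (suc-injective q))
    crossing 1F i 2F j (refl , q) = rotation≢ 1F i (next-injective (suc-injective q))
    crossing 1F i 3F j (refl , q) =
      rotation≢ 0F j (next-injective (next-injective (suc-injective q)))
    crossing 2F i 1F j (p , refl) = rotation≢ 1F j (sym (next-injective (suc-injective p)))
    crossing 3F i 1F j (p , refl) =
      rotation≢ 0F i (sym (next-injective (next-injective (suc-injective p))))
    crossing 2F i 2F j (refl , q) = rotation≢ 5F i (suc-injective q)
    crossing 2F i 3F j (p , refl) = rotation≢ 4F j (sym (next-injective (suc-injective p)))
    crossing 3F i 2F j (refl , q) = rotation≢ 4F i (next-injective (suc-injective q))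
    crossing 3F i 3F j (p , q) with next-injective (suc-injective p)
    ... | refl = rotation≢ 3F i (next-injective (suc-injective q))

-- The exact values

consecutive-range : ∀ {m n} → m ≤ n → n ≤ suc m → n ≡ m ⊎ n ≡ suc m
consecutive-range m≤n n≤1+m with m≤n⇒m<n∨m≡n m≤n
... | inj₁ m<n = inj₂ (≤-antisym n≤1+m m<n)
... | inj₂ m≡n = inj₁ (sym m≡n)

theorem20 : (n : ℕ) (3≤n : 3 ≤ n) →
    (n ≤ 4 → HarmoniousChromaticNumber (Sunflower n 3≤n) 7) ×
    (5 ≤ n → n ≤ 6 → HarmoniousChromaticNumber (Sunflower n 3≤n) 8) ×
    (7 ≤ n → HarmoniousChromaticNumber (Sunflower n 3≤n) (n + 1))
theorem20 n 3≤n = small , medium , large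
  where
  exactly : ∀ {n} (3≤n : 3 ≤ n) {k} (c : SunflowerVertex n → Fin k) → 1 ≤ k →
            EdgesDistinguished c →
            (∀ {l} {c′ : SunflowerVertex n → Fin l} → IsHarmonious (Sunflower n 3≤n) c′ → k ≤ l) →
            HarmoniousChromaticNumber (Sunflower n 3≤n) k
  exactly 3≤n c 1≤k distinguished lower = record
    { positive  = 1≤k
    ; colorable = c , distinguished⇒harmonious 3≤n distinguished
    ; minimal   = λ _ _ (_ , h) → lower h
    }

  small : n ≤ 4 → HarmoniousChromaticNumber (Sunflower n 3≤n) 7
  small n≤4 with consecutive-range 3≤n n≤4
  ... | inj₁ refl = exactly 3≤n colouring₃ (s≤s z≤n) distinguished₃ (lower₃ 3≤n)
  ... | inj₂ refl = exactly 3≤n colouring₄ (s≤s z≤n) distinguished₄ (lower₄ 3≤n)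

  medium : 5 ≤ n → n ≤ 6 → HarmoniousChromaticNumber (Sunflower n 3≤n) 8
  medium 5≤n n≤6 with consecutive-range 5≤n n≤6
  ... | inj₁ refl = exactly 3≤n colouring₅ (s≤s z≤n) distinguished₅ (lower₅ 3≤n)
  ... | inj₂ refl = exactly 3≤n colouring₆ (s≤s z≤n) distinguished₆ (lower₆ 3≤n)

  large : 7 ≤ n → HarmoniousChromaticNumber (Sunflower n 3≤n) (n + 1)
  large 7≤n = subst (HarmoniousChromaticNumber (Sunflower n 3≤n)) (+-comm 1 n)
    -- The outer vertices only repeat rim colours, so the bound from the wheel alone is attained.
    (exactly 3≤n (rotatedColouring n) (s≤s z≤n) (rotated-distinguished 7≤n)
      (ColouredSunflower.1+n≤l 3≤n))
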